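{- Let $\mathcal{A}_1,\mathcal{A}_2$ be classes of sequence automata and $\mathbf{T_1},\mathbf{T_2}$ temporal logics. If $\mathcal{A}_1\leftrightarrows\mathbf{T_1}$, $\mathcal{A}_2\leftrightarrows\mathbf{T_2}$, and $\mathcal{A}_2$ is closed under Boolean operations, then $\mathcal{A}_1(\mathcal{A}_2)\leftrightarrows\mathbf{T_1}(\mathbf{T_2})$.
   Context: For a finite alphabet $\Sigma$, $\mathcal{S}(\Sigma)$ is the set of $\Sigma$-labeled infinite sequences $(\mathbb{N},<,V)$ with $V:\mathbb{N}\to\Sigma$. Sequence automata. A sequence automaton over $\Sigma$ consists of a labeled transition system $(Q,q_0,\Delta,M,\Omega)$, with $Q$ a finite set of states, $q_0\in Q$ initial, $\Delta\subseteq Q\times\Sigma\times Q$, $\Omega$ a finite alphabet, $M\subseteq Q\times\Omega$ a labeling of states, together with an acceptance condition $AC$ on functions $\sigma:\mathbb{N}\to Q$. A run on $(\mathbb{N},<,V)$ is a function $\sigma:\mathbb{N}\to Q$ with $\sigma(0)=q_0$ and $(\sigma(i),V(i),\sigma(i+1))\in\Delta$ for all $i\ge 0$. The sequence is accepted iff some run $\sigma$ on it satisfies $AC(\sigma)$; $\mathcal{L}(A)\subseteq\mathcal{S}(\Sigma)$ is the set of accepted sequences. A class of sequence automata is a set of automata sharing the acceptance condition $AC$: it consists of the labeled transition systems (over any finite input alphabet, with the kind of state labeling $AC$ refers to) equipped with $AC$, where $AC$ may refer to $Q,q_0,M,\Omega$ but not to $\Delta$ or to the input alphabet. A class is closed under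 Boolean operations if, for each finite $\Sigma$, the family of its languages over $\Sigma$ is closed under union, intersection and complement relative to $\mathcal{S}(\Sigma)$. Temporalized automata. $\mathcal{S}(\mathcal{S}(\Sigma))$ is the set of $(\mathbb{N},<,g)$ with $g:\mathbb{N}\to\mathcal{S}(\Sigma)$. Let $\Gamma(\Sigma)$ be a finite alphabet whose symbols are automata of $\mathcal{A}_2$ over $\Sigma$. A temporalized automaton in $\mathcal{A}_1(\mathcal{A}_2)$ over $\Gamma(\Sigma)$ is a labeled transition system $(Q,q_0,\Delta,M,\Omega)$, with $Q$ a finite set of states, $q_0\in Q$ initial, $\Delta\subseteq Q\times\Gamma(\Sigma)\times Q$, $\Omega$ a finite alphabet, and $M\subseteq Q\times\Omega$ a labeling of states (of the kind the acceptance condition of $\mathcal{A}_1$ refers to). A run on $(\mathbb{N},<,g)$ is a function $\sigma:\mathbb{N}\to Q$ with $\sigma(0)=q_0$ such that for every $i\ge0$ there is $B\in\Gamma(\Sigma)$ with $(\sigma(i),B,\sigma(i+1))\in\Delta$ and $g(i)\in\mathcal{L}(B)$. It accepts $(\mathbb{N},<,g)$ iff some run $\sigma$ satisfies the acceptance condition $AC(\sigma)$ of $\mathcal{A}_1$; $\mathcal{L}(A)$ is the set of accepted elements of $\mathcal{S}(\mathcal{S}(\Sigma))$. Temporal logics. A temporal logic $\mathbf{T}$ (here, over infinite sequences) extends propositional logic: its formulas are built from proposition letters with the Boolean connectives and a set $OP(\mathbf{T})$ of temporal operators, and are evaluated at points of models $(\mathbb{N},<,V)$, $V(i)$ being the set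 of letters true at $i$; truth of a formula depends only on the truth sets of the letters occurring (free) in it. A model satisfies a formula if the formula is true at point $0$; $\mathcal{M}(\varphi)$ is the set of models of $\varphi$. A formula is monolithic if its outermost operator is not a Boolean connective (letters included). Temporalization. Assume $OP(\mathbf{T_1})\cap OP(\mathbf{T_2})=\emptyset$. Formulas of $\mathbf{T_1}(\mathbf{T_2})$ are those obtained from $\mathbf{T_1}$'s formation rules by replacing the rule "every proposition letter is a formula" by "every monolithic $\mathbf{T_2}$-formula is a formula", i.e. they are obtained from a $\mathbf{T_1}$-formula by substituting monolithic $\mathbf{T_2}$-formulas for its (free) letters. Models are $(\mathbb{N},<,g)$ with $g$ mapping each $i\in\mathbb{N}$ to a model of $\mathbf{T_2}$; the semantic clauses are those of $\mathbf{T_1}$, except that the clause for letters is replaced by: a monolithic $\mathbf{T_2}$-formula $\alpha$ is true at $i$ iff $g(i)\models\alpha$ in $\mathbf{T_2}$. Notation. $\mathcal{A}\to\mathbf{T}$: for every automaton $A\in\mathcal{A}$ there is a formula $\varphi_A$ of $\mathbf{T}$ with $\mathcal{L}(A)=\mathcal{M}(\varphi_A)$. $\mathbf{T}\to\mathcal{A}$: for every formula $\varphi$ of $\mathbf{T}$ there is $A_\varphi\in\mathcal{A}$ with $\mathcal{M}(\varphi)=\mathcal{L}(A_\varphi)$. $\mathcal{A}\leftrightarrows\mathbf{T}$: both hold. Analogously for $\mathcal{A}_1(\mathcal{A}_2)$ and $\mathbf{T_1}(\mathbf{T_2})$. Labelings are matched as usual: an automaton over $\Sigma$ is compared with formulas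 over letters $\{P_a : a\in\Sigma\}$ on models that are $\Sigma$-labeled sequences, where $P_a$ is true exactly at the points labeled $a$; a formula over a finite set $\mathcal{P}$ of letters is compared with automata over the alphabet $2^{\mathcal{P}}$. -}

module Defs where

open import Data.Empty using (⊥)
open import Data.Fin using (Fin)
open import Data.Fin.Properties using (2↔Bool; *↔×; 1↔⊤)
open import Data.Fin.Subset using (Subset) renaming (_∈_ to _∈ₛ_)
open import Data.Nat using (ℕ; zero; suc; _*_; _^_)
open import Data.Product using (Σ-syntax; ∃-syntax; _×_; _,_; proj₁; uncurry)
open import Data.Product.Function.NonDependent.Propositional using (_×-↔_)
open import Data.Sum using (_⊎_; [_,_])
open import Data.Unit using (⊤; tt)
open import Data.Vec using ([]; _∷_)
open import Function.Bundles using (_↔_; mk↔ₛ′; module Inverse)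
open import Function.Properties.Inverse using (↔-sym; ↔-trans)
open import Level using (0ℓ)
open import Relation.Binary using (REL)
open import Relation.Binary.PropositionalEquality using (_≡_; refl)
open import Relation.Nullary using (¬_)
open import Relation.Unary using (Pred; _∈_; _≐_; _∪_; _∩_; ∁)

record FiniteSet : Set₁ where
  field
    Carrier     : Set
    size        : ℕ
    enumeration : Carrier ↔ Fin size

  index : Carrier → Fin size
  index = Inverse.to enumeration

open FiniteSet public using (index) renaming (Carrier to ∣_∣)

Subset↔Fin : ∀ n → Subset n ↔ Fin (2 ^ n)
Subset↔Fin zero    =
  ↔-trans (mk↔ₛ′ (λ _ → tt) (λ _ → []) (λ _ → refl) (λ { [] → refl })) (↔-sym 1↔⊤)
Subset↔Fin (suc n) =
  ↔-trans (mk↔ₛ′ (λ { (b ∷ bs) → b , bs }) (uncurry _∷_) (λ _ → refl) (λ { (_ ∷ _) → refl }))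
    (↔-trans (↔-sym 2↔Bool ×-↔ Subset↔Fin n) (↔-sym (*↔× {2} {2 ^ n})))

-- Bit vectors rather than functions ∣ P ∣ → Bool, which form a finite type
-- only in the presence of function extensionality.
2^_ : FiniteSet → FiniteSet
2^ P = record
  { Carrier     = Subset (FiniteSet.size P)
  ; size        = 2 ^ FiniteSet.size P
  ; enumeration = Subset↔Fin (FiniteSet.size P)
  }

𝒮 : Set → Set
𝒮 A = ℕ → A

-- The part (Q , q₀ , M , Ω) of a labelled transition system that an acceptance
-- condition may refer to.
record StateSpace : Set₁ where
  field
    Q  : FiniteSet
    q₀ : ∣ Q ∣
    Ω  : FiniteSet
    M  : REL ∣ Q ∣ ∣ Ω ∣ 0ℓ

-- A class is determined by its acceptance condition together with the kind of
-- state labelling this condition is meant for (e.g. a single mark for Büchi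
-- acceptance); Δ and the input alphabet are unconstrained.
record AutomatonClass : Set₁ where
  field
    Kind : Pred StateSpace 0ℓ
    AC   : (S : StateSpace) → Pred (𝒮 ∣ StateSpace.Q S ∣) 0ℓ

record Automaton (𝒜 : AutomatonClass) (Σ : FiniteSet) : Set₁ where
  open AutomatonClass 𝒜
  field
    space : StateSpace
    kind  : space ∈ Kind
  open StateSpace space public
  field
    Δ : ∣ Q ∣ → ∣ Σ ∣ → ∣ Q ∣ → Set

  Accepting : Pred (𝒮 ∣ Q ∣) 0ℓ
  Accepting = AC space

module _ {𝒜 : AutomatonClass} {Σ : FiniteSet} (A : Automaton 𝒜 Σ) where
  open Automaton A

  IsRun : 𝒮 ∣ Σ ∣ → 𝒮 ∣ Q ∣ → Set
  IsRun V σ = σ 0 ≡ q₀ × (∀ i → Δ (σ i) (V i) (σ (suc i)))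

  ℒ : Pred (𝒮 ∣ Σ ∣) 0ℓ
  ℒ V = ∃[ σ ] IsRun V σ × σ ∈ Accepting

record BooleanClosed (𝒜 : AutomatonClass) : Set₁ where
  field
    union        : ∀ {Σ} (A B : Automaton 𝒜 Σ) → ∃[ C ] ℒ {𝒜} {Σ} C ≐ ℒ A ∪ ℒ B
    intersection : ∀ {Σ} (A B : Automaton 𝒜 Σ) → ∃[ C ] ℒ {𝒜} {Σ} C ≐ ℒ A ∩ ℒ B
    complement   : ∀ {Σ} (A : Automaton 𝒜 Σ)   → ∃[ C ] ℒ {𝒜} {Σ} C ≐ ∁ (ℒ A)

-- The alphabet Γ(Σ) is given as a finite set of symbols naming automata.
record TemporalizedAutomaton (𝒜₁ 𝒜₂ : AutomatonClass) (Σ : FiniteSet) : Set₁ where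
  field
    Γ         : FiniteSet
    automaton : ∣ Γ ∣ → Automaton 𝒜₂ Σ
    system    : Automaton 𝒜₁ Γ

module _ {𝒜₁ 𝒜₂ : AutomatonClass} {Σ : FiniteSet}
         (A : TemporalizedAutomaton 𝒜₁ 𝒜₂ Σ) where
  open TemporalizedAutomaton A
  open Automaton system

  IsRunᵗ : 𝒮 (𝒮 ∣ Σ ∣) → 𝒮 ∣ Q ∣ → Set
  IsRunᵗ g σ = σ 0 ≡ q₀ ×
    (∀ i → ∃[ B ] Δ (σ i) B (σ (suc i)) × g i ∈ ℒ (automaton B))

  ℒᵗ : Pred (𝒮 (𝒮 ∣ Σ ∣)) 0ℓ
  ℒᵗ g = ∃[ σ ] IsRunᵗ g σ × σ ∈ Accepting

TruthSet : Set₁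
TruthSet = Pred ℕ 0ℓ

-- An operator o takes arity o arguments and binds binders o i letters in its
-- i-th argument (none, for ordinary modalities such as Until; one, for a
-- quantifier ∃p).  Its meaning is a function of the truth sets of its
-- arguments, each taken as a function of the truth sets of the letters bound in
-- it.  As truth sets are predicates, the meaning has to respect _≐_.  A letter
-- quantifier stays within Set by ranging over characteristic functions ℕ → Bool.
record TemporalLogic : Set₁ where
  field
    Op      : Set
    arity   : Op → ℕ
    binders : (o : Op) → Fin (arity o) → ℕ
    meaning : (o : Op) →
              ((i : Fin (arity o)) → (Fin (binders o i) → TruthSet) → TruthSet) →
              TruthSet
    meaning-cong : ∀ o {F G} →
      (∀ i {X Y : Fin (binders o i) → TruthSet} → (∀ j → X j ≐ Y j) → F i X ≐ G i Y) →
      meaning o F ≐ meaning o G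

module _ (T : TemporalLogic) where
  open TemporalLogic T

  -- Formulas whose free letters are drawn from P; bound letters are nameless.
  data Formula (P : Set) : Set where
    letter : P → Formula P
    ⊤′     : Formula P
    ¬′_    : Formula P → Formula P
    _∧′_   : Formula P → Formula P → Formula P
    op     : (o : Op) → ((i : Fin (arity o)) → Formula (P ⊎ Fin (binders o i))) → Formula P

module _ {T : TemporalLogic} where
  open TemporalLogic T

  ⟦_⟧ : ∀ {P} → Formula T P → (P → TruthSet) → TruthSet
  ⟦ letter p ⟧ v = v p
  ⟦ ⊤′       ⟧ v = λ _ → ⊤
  ⟦ ¬′ φ     ⟧ v = ∁ (⟦ φ ⟧ v)
  ⟦ φ ∧′ ψ   ⟧ v = ⟦ φ ⟧ v ∩ ⟦ ψ ⟧ v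
  ⟦ op o φs  ⟧ v = meaning o (λ i X → ⟦ φs i ⟧ [ v , X ])

  IsMonolithic : ∀ {P} → Formula T P → Set
  IsMonolithic (letter _) = ⊤
  IsMonolithic ⊤′         = ⊥
  IsMonolithic (¬′ _)     = ⊥
  IsMonolithic (_ ∧′ _)   = ⊥
  IsMonolithic (op _ _)   = ⊤

Monolithic : TemporalLogic → Set → Set
Monolithic T P = Σ[ φ ∈ Formula T P ] IsMonolithic φ

-- The two layers keep their own operator types, so disjointness of the two sets
-- of operators needs no assumption.
TemporalizedFormula : TemporalLogic → TemporalLogic → Set → Set
TemporalizedFormula T₁ T₂ P = Formula T₁ (Monolithic T₂ P)

-- A reading of the symbols of an alphabet as sets of letters turns labelled
-- sequences into models.
Reading : Set → Set → Set₁
Reading A P = A → Pred P 0ℓ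

module _ {A P : Set} (ρ : Reading A P) where

  ℳ : {T : TemporalLogic} → Formula T P → Pred (𝒮 A) 0ℓ
  ℳ φ V = ⟦ φ ⟧ (λ p i → ρ (V i) p) 0

  ℳᵗ : {T₁ T₂ : TemporalLogic} → TemporalizedFormula T₁ T₂ P → Pred (𝒮 (𝒮 A)) 0ℓ
  ℳᵗ φ g = ⟦ φ ⟧ (λ α i → g i ∈ ℳ (proj₁ α)) 0

-- Over Σ, the letters are P_a for a ∈ Σ, and P_a holds exactly where the label
-- is a.
symbolReading : (Σ : FiniteSet) → Reading ∣ Σ ∣ ∣ Σ ∣
symbolReading Σ a b = a ≡ b

powersetReading : (P : FiniteSet) → Reading ∣ 2^ P ∣ ∣ P ∣
powersetReading P S p = index P p ∈ₛ S

record _⇆_ (𝒜 : AutomatonClass) (T : TemporalLogic) : Set₁ where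
  field
    automaton⇒formula : ∀ {Σ} (A : Automaton 𝒜 Σ) →
           Σ[ φ ∈ Formula T ∣ Σ ∣ ] ℒ A ≐ ℳ (symbolReading Σ) φ
    formula⇒automaton : ∀ {P} (φ : Formula T ∣ P ∣) →
           Σ[ A ∈ Automaton 𝒜 (2^ P) ] ℳ (powersetReading P) φ ≐ ℒ A

record _⟨_⟩⇆_⟨_⟩ (𝒜₁ 𝒜₂ : AutomatonClass) (T₁ T₂ : TemporalLogic) : Set₁ where
  field
    automaton⇒formula : ∀ {Σ} (A : TemporalizedAutomaton 𝒜₁ 𝒜₂ Σ) →
           Σ[ φ ∈ TemporalizedFormula T₁ T₂ ∣ Σ ∣ ]
             ℒᵗ A ≐ ℳᵗ (symbolReading Σ) {T₁} {T₂} φ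
    formula⇒automaton : ∀ {P} (φ : TemporalizedFormula T₁ T₂ ∣ P ∣) →
           Σ[ A ∈ TemporalizedAutomaton 𝒜₁ 𝒜₂ (2^ P) ]
             ℳᵗ (powersetReading P) {T₁} {T₂} φ ≐ ℒᵗ A

{-# OPTIONS --safe #-}

-- Whatever finitely many properties D k of sequences are involved, a word over
-- sequences is turned into a word over 2^n by recording at each point the set of
-- those k for which D k holds there (its profile).  The languages labelling the
-- transitions of a temporalized automaton may overlap; profiles do not.  So
-- "the profile is S" can both be a letter of the outer layer and, being a Boolean
-- combination of the D k, be expressed by a formula of the inner layer.
--
-- Every T₂-formula becomes a T₁(T₂)-formula when its outer Boolean connectives are
-- read in T₁, since both layers evaluate them at the same sequence g i.

module Submission where

open import Defs
open import Axiom.ExcludedMiddle using (ExcludedMiddle)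
open import Level using (0ℓ)
open import Data.Bool using (true; false)
open import Data.Empty using (⊥-elim)
open import Data.Fin using (Fin; zero; suc)
open import Data.Fin.Subset using (Subset) renaming (_∈_ to _∈ₛ_)
open import Data.List using (List; []; _++_; concat; concatMap; length; lookup)
import Data.List as List
open import Data.List.Membership.Propositional using (lose) renaming (_∈_ to _∈ₗ_)
open import Data.List.Membership.Propositional.Properties
  using (∈-++⁺ˡ; ∈-++⁺ʳ; ∈-concat⁺′; ∈-concatMap⁺; ∈-tabulate⁺)
open import Data.List.Relation.Unary.Any using () renaming (here to hereₗ)
import Data.List.Relation.Unary.Any as Any
open import Data.List.Relation.Unary.Any.Properties using (lookup-index)
open import Data.Nat using (ℕ)
open import Data.Product using (Σ-syntax; ∃-syntax; _×_; _,_; proj₁; proj₂)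
open import Data.Sum using (_⊎_; inj₁; inj₂; [_,_])
open import Data.Unit using (tt)
open import Data.Vec using ([]; _∷_; here; there; tabulate)
open import Data.Vec.Properties using (∷-injective)
open import Function using (_∘_; const; id)
open import Function.Bundles using (_⇔_; mk⇔; module Equivalence; module Inverse)
open import Function.Properties.Inverse using (↔-refl)
open import Relation.Binary.PropositionalEquality using (_≡_; refl; sym; cong; subst)
open import Relation.Nullary using (yes; no; does)
open import Relation.Unary using (_∈_; _≐_)
open import Relation.Unary.Properties using (≐-refl; ≐-trans)

open Equivalence using (to; from)

-- Free letters, relabelling and substitution.

module _ {T : TemporalLogic} where
  open TemporalLogic T

  -- Only finitely many monolithic formulas occur as letters of a given temporalized formula; this
  -- list yields the finite alphabet. Letters bound by an operator are dropped.
  letters : ∀ {P} → Formula T P → List P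
  letters (letter p) = List.[ p ]
  letters ⊤′         = []
  letters (¬′ φ)     = letters φ
  letters (φ ∧′ ψ)   = letters φ ++ letters ψ
  letters (op o φs)  =
    concat (List.tabulate λ i → concatMap [ List.[_] , const [] ] (letters (φs i)))

  letters-op : ∀ {P} o (φs : ∀ i → Formula T (P ⊎ Fin (binders o i))) i {p} →
               inj₁ p ∈ₗ letters (φs i) → p ∈ₗ letters (op o φs)
  letters-op o φs i m =
    ∈-concat⁺′ (∈-concatMap⁺ [ List.[_] , const [] ] (lose m (hereₗ refl))) (∈-tabulate⁺ i)

  -- The proof of occurrence is passed to `f`, so a letter can be sent to its position in the list
  -- without deciding equality of letters.
  relabel : ∀ {P R} (φ : Formula T P) → (∀ p → p ∈ₗ letters φ → R) → Formula T R
  relabel (letter p) f = letter (f p (hereₗ refl))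
  relabel ⊤′         f = ⊤′
  relabel (¬′ φ)     f = ¬′ relabel φ f
  relabel (φ ∧′ ψ)   f =
    relabel φ (λ p → f p ∘ ∈-++⁺ˡ) ∧′ relabel ψ (λ p → f p ∘ ∈-++⁺ʳ (letters φ))
  relabel (op o φs)  f = op o λ i → relabel (φs i) λ where
    (inj₁ p) m → inj₁ (f p (letters-op o φs i m))
    (inj₂ j) m → inj₂ j

  ⟦⟧-relabel : ∀ {P R} (φ : Formula T P) {f : ∀ p → p ∈ₗ letters φ → R} {v w} →
               (∀ p (m : p ∈ₗ letters φ) → v p ≐ w (f p m)) →
               ⟦ φ ⟧ v ≐ ⟦ relabel φ f ⟧ w
  ⟦⟧-relabel (letter p) h = h p (hereₗ refl)
  ⟦⟧-relabel ⊤′         h = ≐-refl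
  ⟦⟧-relabel (¬′ φ)     h =
    let l , r = ⟦⟧-relabel φ h in (λ ¬x x → ¬x (r x)) , (λ ¬x x → ¬x (l x))
  ⟦⟧-relabel (φ ∧′ ψ)   h =
    let l₁ , r₁ = ⟦⟧-relabel φ (λ p → h p ∘ ∈-++⁺ˡ)
        l₂ , r₂ = ⟦⟧-relabel ψ (λ p → h p ∘ ∈-++⁺ʳ (letters φ))
    in (λ (x , y) → l₁ x , l₂ y) , (λ (x , y) → r₁ x , r₂ y)
  ⟦⟧-relabel (op o φs)  h = meaning-cong o λ i X≐Y → ⟦⟧-relabel (φs i) λ where
    (inj₁ p) m → h p (letters-op o φs i m)
    (inj₂ j) m → X≐Y j

  weaken : ∀ {P B} → Formula T P → Formula T (P ⊎ B)
  weaken φ = relabel φ λ p _ → inj₁ p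

  substitute : ∀ {P R} → (P → Formula T R) → Formula T P → Formula T R
  substitute s (letter p) = s p
  substitute s ⊤′         = ⊤′
  substitute s (¬′ φ)     = ¬′ substitute s φ
  substitute s (φ ∧′ ψ)   = substitute s φ ∧′ substitute s ψ
  substitute s (op o φs)  =
    op o λ i → substitute [ weaken ∘ s , letter ∘ inj₂ ] (φs i)

  -- Under an operator, the weakened `s p` ignores the bound letters and these keep their truth
  -- sets, so `meaning-cong` applies.
  ⟦⟧-substitute : ∀ {P R} {s : P → Formula T R} (φ : Formula T P) {v w} →
                  (∀ p → v p ≐ ⟦ s p ⟧ w) → ⟦ φ ⟧ v ≐ ⟦ substitute s φ ⟧ w
  ⟦⟧-substitute         (letter p) h = h p
  ⟦⟧-substitute         ⊤′         h = ≐-refl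
  ⟦⟧-substitute         (¬′ φ)     h =
    let l , r = ⟦⟧-substitute φ h in (λ ¬x x → ¬x (r x)) , (λ ¬x x → ¬x (l x))
  ⟦⟧-substitute         (φ ∧′ ψ)   h =
    let l₁ , r₁ = ⟦⟧-substitute φ h
        l₂ , r₂ = ⟦⟧-substitute ψ h
    in (λ (x , y) → l₁ x , l₂ y) , (λ (x , y) → r₁ x , r₂ y)
  ⟦⟧-substitute {s = s} (op o φs)  h = meaning-cong o λ i X≐Y →
    ⟦⟧-substitute (φs i) λ where
      (inj₁ p) → ≐-trans (h p) (⟦⟧-relabel (s p) λ _ _ → ≐-refl)
      (inj₂ j) → X≐Y j

-- Inner formulas read in the outer logic, and profiles.

module _ {T₁ T₂ : TemporalLogic} where

  temporalize : ∀ {P} → Formula T₂ P → TemporalizedFormula T₁ T₂ P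
  temporalize (letter p) = letter (letter p , tt)
  temporalize ⊤′         = ⊤′
  temporalize (¬′ φ)     = ¬′ temporalize φ
  temporalize (φ ∧′ ψ)   = temporalize φ ∧′ temporalize ψ
  temporalize (op o φs)  = letter (op o φs , tt)

  -- The recursion stops at monolithic formulas, whose truth as outer letters is by definition
  -- membership of `g i` in `ℳ`.
  ⟦⟧-temporalize : ∀ {A P} (ρ : Reading A P) (φ : Formula T₂ P) (g : 𝒮 (𝒮 A)) →
                   (λ i → g i ∈ ℳ ρ φ) ≐
                   ⟦ temporalize φ ⟧ (λ α i → g i ∈ ℳ ρ (proj₁ α))
  ⟦⟧-temporalize ρ (letter p) g = ≐-refl
  ⟦⟧-temporalize ρ ⊤′         g = ≐-refl
  ⟦⟧-temporalize ρ (¬′ φ)     g =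
    let l , r = ⟦⟧-temporalize ρ φ g in (λ ¬x x → ¬x (r x)) , (λ ¬x x → ¬x (l x))
  ⟦⟧-temporalize ρ (φ ∧′ ψ)   g =
    let l₁ , r₁ = ⟦⟧-temporalize ρ φ g
        l₂ , r₂ = ⟦⟧-temporalize ρ ψ g
    in (λ (x , y) → l₁ x , l₂ y) , (λ (x , y) → r₁ x , r₂ y)
  ⟦⟧-temporalize ρ (op o φs)  g = ≐-refl

-- The minterm of `S`. It is formed in `T₁` when an automaton is translated and in `T₂` when a
-- formula is.
signed : ∀ {T P n} → Subset n → (Fin n → Formula T P) → Formula T P
signed []          ψ = ⊤′
signed (true  ∷ S) ψ = ψ zero ∧′ signed S (ψ ∘ suc)
signed (false ∷ S) ψ = (¬′ ψ zero) ∧′ signed S (ψ ∘ suc)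

module _ (em : ExcludedMiddle 0ℓ) where

  profile : ∀ {n} → (Fin n → Set) → Subset n
  profile D = tabulate λ k → does (em {D k})

  ∈-profile : ∀ {n} (D : Fin n → Set) k → D k ⇔ k ∈ₛ profile D
  ∈-profile D k = mk⇔ (⇒ D k) (⇐ D k)
    where
    ⇒ : ∀ {n} (D : Fin n → Set) k → D k → k ∈ₛ profile D
    ⇒ D zero d with em {D zero}
    ... | yes _ = here
    ... | no ¬d = ⊥-elim (¬d d)
    ⇒ D (suc k) d = there (⇒ (D ∘ suc) k d)

    ⇐ : ∀ {n} (D : Fin n → Set) k → k ∈ₛ profile D → D k
    ⇐ D zero m with em {D zero} | m
    ... | yes d | _ = d
    ... | no _  | ()
    ⇐ D (suc k) (there m) = ⇐ (D ∘ suc) k m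

  -- Bits are compared one by one: a wrong first bit refutes both the equation and the first
  -- conjunct, a right one leaves the claim for the tails.
  ⟦⟧-signed : ∀ {T P n} (D : Fin n → Set) S (ψ : Fin n → Formula T P) {v i} →
              (∀ k → D k ⇔ i ∈ ⟦ ψ k ⟧ v) →
              profile D ≡ S ⇔ i ∈ ⟦ signed S ψ ⟧ v
  ⟦⟧-signed D []          ψ h = mk⇔ (λ _ → tt) (λ _ → refl)
  ⟦⟧-signed D (true  ∷ S) ψ h with em {D zero} | ⟦⟧-signed (D ∘ suc) S (ψ ∘ suc) (h ∘ suc)
  ... | yes d | e = mk⇔ (λ eq → to (h zero) d , to e (proj₂ (∷-injective eq)))
                        (λ (_ , x) → cong (true ∷_) (from e x))
  ... | no ¬d | e = mk⇔ (λ ()) (λ (x , _) → ⊥-elim (¬d (from (h zero) x)))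
  ⟦⟧-signed D (false ∷ S) ψ h with em {D zero} | ⟦⟧-signed (D ∘ suc) S (ψ ∘ suc) (h ∘ suc)
  ... | yes d | e = mk⇔ (λ ()) (λ (¬x , _) → ⊥-elim (¬x (to (h zero) d)))
  ... | no ¬d | e = mk⇔ (λ eq → ¬d ∘ from (h zero) , to e (proj₂ (∷-injective eq)))
                        (λ (_ , x) → cong (false ∷_) (from e x))

  module _ {𝒜₁ 𝒜₂ : AutomatonClass} {T₁ T₂ : TemporalLogic}
           (h₁ : 𝒜₁ ⇆ T₁) (h₂ : 𝒜₂ ⇆ T₂) where

    -- From temporalized automata to formulas.

    module _ {Σ : FiniteSet} (A : TemporalizedAutomaton 𝒜₁ 𝒜₂ Σ) where
      open TemporalizedAutomaton A
      open Automaton system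

      private
        n = FiniteSet.size Γ
        open Inverse (FiniteSet.enumeration Γ)
          using (strictlyInverseʳ) renaming (to to position; from to symbol)

        β : ∀ k → Formula T₂ ∣ Σ ∣
        β k = proj₁ (_⇆_.automaton⇒formula h₂ (automaton (symbol k)))

        β-correct : ∀ k → ℒ (automaton (symbol k)) ≐ ℳ (symbolReading Σ) (β k)
        β-correct k = proj₂ (_⇆_.automaton⇒formula h₂ (automaton (symbol k)))

      -- The choice of `k` in the profile read takes over the choice, in `IsRunᵗ`, of a symbol whose
      -- language contains `g i`.
      profileSystem : Automaton 𝒜₁ (2^ Γ)
      profileSystem = record
        { space = space
        ; kind  = kind
        ; Δ     = λ q S q′ → ∃[ k ] k ∈ₛ S × Δ q (symbol k) q′
        }

      holdsAt : 𝒮 (𝒮 ∣ Σ ∣) → ℕ → Fin n → Set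
      holdsAt g i k = g i ∈ ℒ (automaton (symbol k))

      -- The state space is shared, so the same `σ` is a run on both sides and acceptance carries
      -- over unchanged.
      ℒᵗ⇔ℒ-profileSystem : ∀ g → g ∈ ℒᵗ A ⇔ (λ i → profile (holdsAt g i)) ∈ ℒ profileSystem
      ℒᵗ⇔ℒ-profileSystem g = mk⇔
        (λ (σ , (σ₀ , steps) , acc) → σ , (σ₀ , λ i → ⇒ (steps i)) , acc)
        (λ (σ , (σ₀ , steps) , acc) → σ , (σ₀ , λ i → ⇐ (steps i)) , acc)
        where
        ⇒ : ∀ {i q q′} → ∃[ B ] Δ q B q′ × g i ∈ ℒ (automaton B) →
            ∃[ k ] k ∈ₛ profile (holdsAt g i) × Δ q (symbol k) q′
        ⇒ {i} {q} {q′} (B , δ , b) =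
          position B
          , to (∈-profile (holdsAt g i) _)
              (subst (λ B → g i ∈ ℒ (automaton B)) (sym (strictlyInverseʳ B)) b)
          , subst (λ B → Δ q B q′) (sym (strictlyInverseʳ B)) δ

        ⇐ : ∀ {i q q′} → ∃[ k ] k ∈ₛ profile (holdsAt g i) × Δ q (symbol k) q′ →
            ∃[ B ] Δ q B q′ × g i ∈ ℒ (automaton B)
        ⇐ {i} (k , m , δ) = symbol k , δ , from (∈-profile (holdsAt g i) k) m

      temporalizedAutomaton⇒formula :
        Σ[ φ ∈ TemporalizedFormula T₁ T₂ ∣ Σ ∣ ]
          ℒᵗ A ≐ ℳᵗ (symbolReading Σ) {T₁} {T₂} φ
      temporalizedAutomaton⇒formula =
        substitute hasProfile φ
        , (λ {g} → proj₁ (correct g) ∘ proj₁ φ-correct ∘ to (ℒᵗ⇔ℒ-profileSystem g))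
        , (λ {g} → from (ℒᵗ⇔ℒ-profileSystem g) ∘ proj₂ φ-correct ∘ proj₂ (correct g))
        where
        φ-spec = _⇆_.automaton⇒formula h₁ profileSystem
        φ = proj₁ φ-spec
        φ-correct = proj₂ φ-spec

        hasProfile : Subset n → TemporalizedFormula T₁ T₂ ∣ Σ ∣
        hasProfile S = signed S (temporalize ∘ β)

        -- The left valuation is `symbolReading` on the word of profiles.
        correct : ∀ g → ⟦ φ ⟧ (λ S i → profile (holdsAt g i) ≡ S) ≐
                        ⟦ substitute hasProfile φ ⟧ (λ α i → g i ∈ ℳ (symbolReading Σ) (proj₁ α))
        correct g = ⟦⟧-substitute φ λ S →
          (λ {i} → to (e i S)) , (λ {i} → from (e i S))
          where
          e : ∀ i S → profile (holdsAt g i) ≡ S ⇔ _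
          e i S = ⟦⟧-signed (holdsAt g i) S (temporalize ∘ β) λ k →
            let l , r = ⟦⟧-temporalize {T₁} (symbolReading Σ) (β k) g
            in mk⇔ (l ∘ proj₁ (β-correct k)) (proj₂ (β-correct k) ∘ r)

    -- From temporalized formulas to automata.

    module _ {P : FiniteSet} (φ : TemporalizedFormula T₁ T₂ ∣ P ∣) where

      private
        n = length (letters φ)

        positions : FiniteSet
        positions = record { Carrier = Fin n ; size = n ; enumeration = ↔-refl }

        α : Fin n → Monolithic T₂ ∣ P ∣
        α = lookup (letters φ)

        system-spec = _⇆_.formula⇒automaton h₁ {positions} (relabel φ λ _ → Any.index)

        inner-spec : ∀ S → Σ[ A ∈ Automaton 𝒜₂ (2^ P) ]
          ℳ (powersetReading P) (signed S (proj₁ ∘ α)) ≐ ℒ A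
        inner-spec S = _⇆_.formula⇒automaton h₂ {P} (signed S (proj₁ ∘ α))

        -- The languages of the symbols partition all sequences by profile, so exactly one symbol
        -- fits each `g i`.
        profileAutomaton : TemporalizedAutomaton 𝒜₁ 𝒜₂ (2^ P)
        profileAutomaton = record
          { Γ         = 2^ positions
          ; automaton = proj₁ ∘ inner-spec
          ; system    = proj₁ system-spec
          }

        open Automaton (proj₁ system-spec)

      module _ (g : 𝒮 (𝒮 ∣ 2^ P ∣)) where

        private
          v : Monolithic T₂ ∣ P ∣ → TruthSet
          v α i = g i ∈ ℳ (powersetReading P) (proj₁ α)

          V : 𝒮 (Subset n)
          V i = profile λ k → i ∈ v (α k)

          V-correct : ∀ i S → V i ≡ S ⇔ g i ∈ ℒ (proj₁ (inner-spec S))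
          V-correct i S = mk⇔ (l ∘ to e) (from e ∘ r)
            where
            e = ⟦⟧-signed _ S (proj₁ ∘ α) λ _ → mk⇔ id id
            l = proj₁ (proj₂ (inner-spec S))
            r = proj₂ (proj₂ (inner-spec S))

        ℒ⇔ℒᵗ-profileAutomaton : V ∈ ℒ (proj₁ system-spec) ⇔ g ∈ ℒᵗ profileAutomaton
        ℒ⇔ℒᵗ-profileAutomaton = mk⇔
          (λ (σ , (σ₀ , steps) , acc) →
            σ , (σ₀ , λ i → V i , steps i , to (V-correct i (V i)) refl) , acc)
          (λ (σ , (σ₀ , steps) , acc) → σ , (σ₀ , λ i → ⇐ (steps i)) , acc)
          where
          ⇐ : ∀ {i q q′} → ∃[ S ] Δ q S q′ × g i ∈ ℒ (proj₁ (inner-spec S)) → Δ q (V i) q′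
          ⇐ {i} {q} {q′} (S , δ , b) =
            -- Disjointness of these languages forces the symbol `S` used at `i` to be `V i`.
            subst (λ S → Δ q S q′) (sym (from (V-correct i S) b)) δ

        -- The right valuation is `powersetReading positions` along `V`, because `positions` is
        -- enumerated by the identity. Looking up the index of an occurrence recovers the letter.
        ⟦⟧-relabel-index :
          ⟦ φ ⟧ v ≐ ⟦ relabel φ (λ _ → Any.index) ⟧ (λ k i → k ∈ₛ V i)
        ⟦⟧-relabel-index = ⟦⟧-relabel φ λ _ m →
          (λ {i} x → to (∈-profile _ _) (subst (λ α → i ∈ v α) (lookup-index m) x))
          , (λ {i} x → subst (λ α → i ∈ v α) (sym (lookup-index m)) (from (∈-profile _ _) x))

      temporalizedFormula⇒automaton :
        Σ[ A ∈ TemporalizedAutomaton 𝒜₁ 𝒜₂ (2^ P) ]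
          ℳᵗ (powersetReading P) {T₁} {T₂} φ ≐ ℒᵗ A
      temporalizedFormula⇒automaton =
        profileAutomaton
        , (λ {g} → to (ℒ⇔ℒᵗ-profileAutomaton g) ∘ proj₁ system-correct ∘ proj₁ (⟦⟧-relabel-index g))
        , (λ {g} → proj₂ (⟦⟧-relabel-index g) ∘ proj₂ system-correct ∘ from (ℒ⇔ℒᵗ-profileAutomaton g))
        where system-correct = proj₂ system-spec

theorem2p10 : ExcludedMiddle 0ℓ →
    (𝒜₁ 𝒜₂ : AutomatonClass) (T₁ T₂ : TemporalLogic) →
    𝒜₁ ⇆ T₁ → 𝒜₂ ⇆ T₂ → BooleanClosed 𝒜₂ →
    𝒜₁ ⟨ 𝒜₂ ⟩⇆ T₁ ⟨ T₂ ⟩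
theorem2p10 em 𝒜₁ 𝒜₂ T₁ T₂ h₁ h₂ _ = record
  { automaton⇒formula = temporalizedAutomaton⇒formula em h₁ h₂
  ; formula⇒automaton = λ {P} → temporalizedFormula⇒automaton em h₁ h₂ {P}
  }
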